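{- For all integers $d \geq 2$ and $n \geq d(d+2)$, there exists a connected graph $G$ on $n$ vertices with minimum degree $d$ such that every spanning tree $T$ of $G$ has an internal vertex whose degree in $T$ is equal to $2$.
   Context: Graphs are finite, simple and undirected. An internal vertex of a tree $T$ is a vertex of $T$ that is not a leaf, i.e. a vertex whose degree in $T$ is at least $2$. -}

module Defs where

open import Data.Fin using (Fin; zero; suc; inject₁; fromℕ)
open import Data.Fin.Subset using (Subset; ∣_∣)
open import Data.Nat using (ℕ; _+_; _≤_)
open import Data.Product using (_×_; ∃)
open import Data.Vec using (tabulate)
open import Function.Definitions using (Injective)
open import Level using (0ℓ)
open import Relation.Binary.Construct.Closure.ReflexiveTransitive using (Star)
open import Relation.Binary.Core using (Rel; _⇒_)
open import Relation.Binary.Definitions using (Decidable; Symmetric; Irreflexive)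
open import Relation.Binary.PropositionalEquality using (_≡_)
open import Relation.Nullary using (¬_; does)

-- Adjacency is required to be decidable, as it is for a graph given by a
-- finite edge set; this is what makes degrees computable.
record Graph (n : ℕ) : Set₁ where
  field
    Adj    : Rel (Fin n) 0ℓ
    adj?   : Decidable Adj
    sym    : Symmetric Adj
    irrefl : Irreflexive _≡_ Adj

open Graph public using (Adj; adj?)

module _ {n : ℕ} (G : Graph n) where

  neighbours : Fin n → Subset n
  neighbours v = tabulate λ w → does (adj? G v w)

  degree : Fin n → ℕ
  degree v = ∣ neighbours v ∣

  MinDegree : ℕ → Set
  MinDegree d = (∀ v → d ≤ degree v) × ∃ λ v → degree v ≡ d

  Connected : Set
  Connected = ∀ u v → Star (Adj G) u v

  -- A cycle on 3 + k distinct vertices, listed in cyclic order.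
  record Cycle : Set where
    field
      k         : ℕ
      vertex    : Fin (3 + k) → Fin n
      injective : Injective _≡_ _≡_ vertex
      step      : ∀ (i : Fin (2 + k)) → Adj G (vertex (inject₁ i)) (vertex (suc i))
      close     : Adj G (vertex (fromℕ (2 + k))) (vertex zero)

  Acyclic : Set
  Acyclic = ¬ Cycle

  IsTree : Set
  IsTree = Connected × Acyclic

  Internal : Fin n → Set
  Internal v = 2 ≤ degree v

-- T and G share the vertex set Fin n, so T is automatically spanning.
IsSpanningTree : ∀ {n} → Graph n → Graph n → Set
IsSpanningTree T G = (Adj T ⇒ Adj G) × IsTree T

{-# OPTIONS --safe #-}
-- G consists of d blocks, each a clique on at least d + 1 vertices, together
-- with d core vertices, one per block, that are pairwise adjacent; the core
-- vertex of a block has a single neighbour (the gate) in its block.  The edge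
-- from a core vertex to its gate is a bridge, hence lies in every spanning tree
-- T, and by connectivity T also joins each core vertex to another one.  If no
-- core vertex had T-degree 2, each would have T-degree at least 3, hence two
-- core T-neighbours, and one could walk in T through the core forever without
-- turning back; such a walk in a finite graph contains a cycle.
module Submission where

open import Data.Fin using (Fin; zero; suc; toℕ; inject₁; punchIn; combine; quotient; splitAt; _↑ˡ_; _≟_)
open import Data.Fin.Properties using (any?; pigeonhole; toℕ<n; toℕ-injective; toℕ-inject₁; inject₁-injective; toℕ-fromℕ; suc-injective; punchIn-injective; punchInᵢ≢i; remQuot-combine; combine-injectiveʳ; splitAt-↑ˡ; ↑ˡ-injective)
open import Data.Fin.Subset using (Subset; ∣_∣; _∈_; _-_; inside; outside)
open import Data.Fin.Subset.Properties using (Empty-unique; ∣⊥∣≡0; p─⊥≡p; p─q⊆p; x∈p∧x≢y⇒x∈p-y; x∈p⇒∣p-x∣<∣p∣)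
open import Data.Nat using (ℕ; zero; suc; _+_; _*_; _∸_; _≤_; _<_; z≤n; s≤s)
open import Data.Nat.Properties using (≤-trans; ≤-reflexive; ≤-antisym; ≤∧≢⇒<; <⇒≤; <⇒≱; <-cmp; _<?_; n≤1+n; n<1+n; +-comm; +-assoc; m∸n≤m; m∸n+n≡m; m<n⇒0<n∸m; m≤n⇒∃[o]m+o≡n) renaming (_≟_ to _≟ℕ_)
open import Data.Nat.Induction using (<-rec)
open import Data.Product using (_×_; ∃; _,_; proj₁; proj₂)
open import Data.Sum using (_⊎_; inj₁; inj₂; [_,_]′)
open import Data.Vec using (_∷_; there)
open import Data.Vec.Properties using (lookup∘tabulate; lookup⇒[]=; []=⇒lookup)
open import Function using (_∘_; case_of_)
open import Function.Definitions using (Injective)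
open import Level using (0ℓ)
open import Relation.Binary.Construct.Closure.ReflexiveTransitive using (Star; ε; _◅_; _◅◅_; reverse)
open import Relation.Binary.Definitions using (tri<; tri≈; tri>)
open import Relation.Binary.PropositionalEquality using (_≡_; _≢_; refl; sym; trans; cong; subst; subst₂; ≢-sym)
open import Relation.Nullary using (¬_; yes; no; does; contradiction)
open import Relation.Nullary.Decidable using (dec-true; _×-dec_; _⊎-dec_; _→-dec_; ¬?; decidable-stable)
open import Relation.Unary using (Pred; Decidable)
open import Defs

-- Sizes of finite subsets

injection⇒≤∣p∣ : ∀ {k n} {p : Subset n} (f : Fin k → Fin n) →
  Injective _≡_ _≡_ f → (∀ i → f i ∈ p) → k ≤ ∣ p ∣
injection⇒≤∣p∣ {zero}  f inj f∈p = z≤n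
injection⇒≤∣p∣ {suc k} {p = p} f inj f∈p = ≤-trans
  (s≤s (injection⇒≤∣p∣ {p = p - f zero} (f ∘ suc) (suc-injective ∘ inj)
    λ i → x∈p∧x≢y⇒x∈p-y (f∈p (suc i)) λ eq → case inj eq of λ ()))
  (x∈p⇒∣p-x∣<∣p∣ {p = p} (f∈p zero))

∣p∣≤1+∣p-x∣ : ∀ {n} (p : Subset n) x → ∣ p ∣ ≤ suc ∣ p - x ∣
∣p∣≤1+∣p-x∣ (inside  ∷ p) zero    = s≤s (≤-reflexive (cong ∣_∣ (sym (p─⊥≡p p))))
∣p∣≤1+∣p-x∣ (outside ∷ p) zero    = ≤-trans (≤-reflexive (cong ∣_∣ (sym (p─⊥≡p p)))) (n≤1+n _)
∣p∣≤1+∣p-x∣ (inside  ∷ p) (suc x) = s≤s (∣p∣≤1+∣p-x∣ p x)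
∣p∣≤1+∣p-x∣ (outside ∷ p) (suc x) = ∣p∣≤1+∣p-x∣ p x

-- The values of `f` may lie outside `p`, so removing one of them lowers the size by at most one.
surjection⇒∣p∣≤ : ∀ {k n} {p : Subset n} (f : Fin k → Fin n) →
  (∀ {x} → x ∈ p → ∃ λ i → f i ≡ x) → ∣ p ∣ ≤ k
surjection⇒∣p∣≤ {zero} {n} {p} f sur
  rewrite Empty-unique {p = p} (λ (_ , x∈p) → case sur x∈p of λ ()) = ≤-reflexive (∣⊥∣≡0 n)
surjection⇒∣p∣≤ {suc k} {p = p} f sur =
  ≤-trans (∣p∣≤1+∣p-x∣ p (f zero)) (s≤s (surjection⇒∣p∣≤ (f ∘ suc) sur′))
  where
  x∉p-x : ∀ {n} (p : Subset n) x → ¬ x ∈ p - x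
  x∉p-x (_ ∷ p) zero    ()
  x∉p-x (_ ∷ p) (suc x) (there x∈) = x∉p-x p x x∈
  sur′ : ∀ {x} → x ∈ p - f zero → ∃ λ i → f (suc i) ≡ x
  sur′ x∈ with sur (p─q⊆p p _ x∈)
  ... | suc i , eq   = i , eq
  ... | zero  , refl = contradiction x∈ (x∉p-x p _)

-- Degree bounds from enumerations of neighbours

module _ {n} (G : Graph n) where

  Adj⇒∈ : ∀ {v w} → Adj G v w → w ∈ neighbours G v
  Adj⇒∈ {v} {w} vw = lookup⇒[]= w _ (trans (lookup∘tabulate _ w) (dec-true (adj? G v w) vw))

  ∈⇒Adj : ∀ {v w} → w ∈ neighbours G v → Adj G v w
  ∈⇒Adj {v} {w} w∈ with adj? G v w | trans (sym (lookup∘tabulate (λ w → does (adj? G v w)) w)) ([]=⇒lookup w∈)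
  ... | yes vw | _ = vw
  ... | no _   | ()

  ≤degree : ∀ {k v} (f : Fin k → Fin n) → Injective _≡_ _≡_ f → (∀ i → Adj G v (f i)) → k ≤ degree G v
  ≤degree f inj adj = injection⇒≤∣p∣ f inj (Adj⇒∈ ∘ adj)

  degree≤ : ∀ {k v} (f : Fin k → Fin n) → (∀ {w} → Adj G v w → ∃ λ i → f i ≡ w) → degree G v ≤ k
  degree≤ f sur = surjection⇒∣p∣≤ f (sur ∘ ∈⇒Adj)

pair : ∀ {A : Set} → A → A → Fin 2 → A
pair a b zero    = a
pair a b (suc _) = b

module _ {n} (G : Graph n) where

  2≤degree : ∀ {v a b} → a ≢ b → Adj G v a → Adj G v b → 2 ≤ degree G v
  2≤degree {v} {a} {b} a≢b va vb = ≤degree G (pair a b) inj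
    (λ { zero → va ; (suc zero) → vb })
    where
    inj : Injective _≡_ _≡_ (pair a b)
    inj {zero}     {zero}     _  = refl
    inj {zero}     {suc zero} eq = contradiction eq a≢b
    inj {suc zero} {zero}     eq = contradiction (sym eq) a≢b
    inj {suc zero} {suc zero} _  = refl

  -- Otherwise `pair a b` would cover all neighbours of `v`, making the degree at most 2.
  third-neighbour : ∀ {v} a b → 2 < degree G v → ∃ λ w → Adj G v w × w ≢ a × w ≢ b
  third-neighbour {v} a b 2<deg
    with any? (λ w → adj? G v w ×-dec ¬? (w ≟ a) ×-dec ¬? (w ≟ b))
  ... | yes found = found
  ... | no none = contradiction (degree≤ G (pair a b) cover) (<⇒≱ 2<deg)
    where
    cover : ∀ {w} → Adj G v w → ∃ λ i → pair a b i ≡ w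
    cover {w} vw with w ≟ a | w ≟ b
    ... | yes refl | _        = zero , refl
    ... | no _     | yes refl = suc zero , refl
    ... | no w≢a   | no w≢b   = contradiction (w , vw , w≢a , w≢b) none

-- The first edge of the path that leaves `P` works. Applied to a cut, this turns connectivity of
-- the tree into a tree edge across the cut.
crossing : ∀ {A : Set} {R : A → A → Set} {P : Pred A 0ℓ} → Decidable P →
  ∀ {u v} → Star R u v → P u → ¬ P v → ∃ λ x → ∃ λ y → R x y × P x × ¬ P y
crossing P? ε Pu ¬Pv = contradiction Pu ¬Pv
crossing P? (_◅_ {j = w} uw w⇝v) Pu ¬Pv with P? w
... | yes Pw = crossing P? w⇝v Pw ¬Pv
... | no ¬Pw = _ , w , uw , Pu , ¬Pw

-- Cycles from walks that never turn back

module _ {n} (T : Graph n) where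

  module _ (w : ℕ → Fin n) (adj : ∀ i → Adj T (w i) (w (suc i))) (nb : ∀ i → w i ≢ w (2 + i)) where

    -- Among the returns of the walk, one of minimal length is a cycle.
    return⇒cycle : ∀ k i → 0 < k → w i ≡ w (k + i) → Cycle T
    return⇒cycle = <-rec _ go
      where
      go : ∀ k → (∀ {l} → l < k → ∀ i → 0 < l → w i ≡ w (l + i) → Cycle T) →
           ∀ i → 0 < k → w i ≡ w (k + i) → Cycle T
      go 1 rec i _ eq = contradiction (adj i) (Graph.irrefl T eq)
      go 2 rec i _ eq = contradiction eq (nb i)
      go (suc (suc (suc m))) rec i _ eq
        with any? (λ p → any? (λ q → (toℕ {3 + m} p <? toℕ {3 + m} q) ×-dec (w (toℕ p + i) ≟ w (toℕ q + i))))
      -- A repetition inside the return is itself a return, of length `q ∸ p`, at most `q` and hence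
      -- below `3 + m`.
      ... | yes (p , q , p<q , wp≡wq) = rec
        (≤-trans (s≤s (m∸n≤m (toℕ q) (toℕ p))) (toℕ<n q)) (toℕ p + i) (m<n⇒0<n∸m p<q)
        (trans wp≡wq (cong w (trans (cong (_+ i) (sym (m∸n+n≡m (<⇒≤ p<q)))) (+-assoc (toℕ q ∸ toℕ p) (toℕ p) i))))
      -- The vertices at times `i` to `2 + m + i` are distinct; the next step of the walk ends at
      -- `w i` and closes the cycle.
      ... | no none = record
        { k = m
        ; vertex = vertex
        ; injective = inj
        ; step = λ p → subst (λ a → Adj T (w (a + i)) (w (suc (toℕ p + i)))) (sym (toℕ-inject₁ p)) (adj _)
        ; close = subst₂ (Adj T) (cong (λ a → w (a + i)) (sym (toℕ-fromℕ (2 + m)))) (sym eq) (adj _)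
        }
        where
        vertex : Fin (3 + m) → Fin n
        vertex p = w (toℕ p + i)
        inj : Injective _≡_ _≡_ vertex
        inj {p} {q} eq with <-cmp (toℕ p) (toℕ q)
        ... | tri< p<q _ _ = contradiction (p , q , p<q , eq) none
        ... | tri≈ _ p≡q _ = toℕ-injective p≡q
        ... | tri> _ _ q<p = contradiction (q , p , q<p , sym eq) none

    walk⇒cycle : Cycle T
    walk⇒cycle with i , j , i<j , eq ← pigeonhole (n<1+n n) (w ∘ toℕ) =
      return⇒cycle (toℕ j ∸ toℕ i) (toℕ i) (m<n⇒0<n∸m i<j)
        (trans eq (cong w (sym (m∸n+n≡m (<⇒≤ i<j)))))

  -- Iterating `next` gives an infinite walk; the state is the last edge, because the vertex to
  -- avoid is the previous one.
  continue⇒cycle : (C : Pred (Fin n) 0ℓ) →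
    (∀ u v → C v → ∃ λ w → Adj T v w × C w × w ≢ u) →
    ∃ C → Cycle T
  continue⇒cycle C next (v₀ , Cv₀) = walk⇒cycle walk adj nb
    where
    Arc : Set
    Arc = ∃ λ u → ∃ λ v → Adj T u v × C v
    advance : Arc → Arc
    advance (u , v , _ , Cv) with w , vw , Cw , _ ← next u v Cv = v , w , vw , Cw
    arcs : ℕ → Arc
    -- There is no previous vertex at the start, so `v₀` itself serves as a dummy.
    arcs zero with w , vw , Cw , _ ← next v₀ v₀ Cv₀ = v₀ , w , vw , Cw
    arcs (suc i) = advance (arcs i)
    walk : ℕ → Fin n
    walk i = proj₁ (arcs i)
    adj : ∀ i → Adj T (walk i) (walk (suc i))
    adj i = proj₁ (proj₂ (proj₂ (arcs i)))
    nb : ∀ i → walk i ≢ walk (2 + i)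
    nb i with u , v , _ , Cv ← arcs i = ≢-sym (proj₂ (proj₂ (proj₂ (next u v Cv))))

-- The graph and its minimum degree

module Construction {m n : ℕ}
  (blk : Fin n → Fin (2 + m))
  -- Each of the `d` blocks, `d` being `2 + m`, has `d + 2` named slots: the core vertex, the gate
  -- and `d` more clique vertices. Vertices of a block outside its slots also join the clique.
  (slot : Fin (2 + m) → Fin (4 + m) → Fin n)
  (blk-slot : ∀ i j → blk (slot i j) ≡ i)
  (slot-injective : ∀ i → Injective _≡_ _≡_ (slot i))
  where

  d : ℕ
  d = 2 + m

  core gate : Fin d → Fin n
  core i = slot i zero
  gate i = slot i (suc zero)

  other : Fin d → Fin d
  other i = punchIn i zero

  Core Gate : Pred (Fin n) 0ℓ
  Core v = v ≡ core (blk v)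
  Gate v = v ≡ gate (blk v)

  core? : Decidable Core
  core? v = v ≟ core (blk v)

  gate? : Decidable Gate
  gate? v = v ≟ gate (blk v)

  Core-core : ∀ i → Core (core i)
  Core-core i = cong core (sym (blk-slot i zero))

  Gate-gate : ∀ i → Gate (gate i)
  Gate-gate i = cong gate (sym (blk-slot i (suc zero)))

  ¬Core-slot : ∀ i j → ¬ Core (slot i (suc j))
  ¬Core-slot i j c with () ← slot-injective i (trans c (cong core (blk-slot i (suc j))))

  core≢slot : ∀ i j k → core i ≢ slot j (suc k)
  core≢slot i j k eq = ¬Core-slot j k (subst Core eq (Core-core i))

  core-injective : Injective _≡_ _≡_ core
  core-injective {i} {j} eq = trans (sym (blk-slot i zero)) (trans (cong blk eq) (blk-slot j zero))

  Core⇒core : ∀ {v i} → Core v → blk v ≡ i → v ≡ core i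
  Core⇒core c refl = c

  -- For two non-core vertices of one block both implications are vacuous, which yields the clique;
  -- for a core vertex they leave only its gate.
  Joined : Fin n → Fin n → Set
  Joined u v = (Core u × Core v) ⊎ (blk u ≡ blk v × (Core u → Gate v) × (Core v → Gate u))

  G : Graph n
  G = record
    { Adj    = λ u v → u ≢ v × Joined u v
    ; adj?   = λ u v → ¬? (u ≟ v) ×-dec ((core? u ×-dec core? v) ⊎-dec
                 ((blk u ≟ blk v) ×-dec (core? u →-dec gate? v) ×-dec (core? v →-dec gate? u)))
    ; sym    = λ { (u≢v , inj₁ (cu , cv)) → ≢-sym u≢v , inj₁ (cv , cu)
                 ; (u≢v , inj₂ (b , f , g)) → ≢-sym u≢v , inj₂ (sym b , g , f) }
    ; irrefl = λ u≡v uv → proj₁ uv u≡v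
    }

  core-gate : ∀ i → Adj G (core i) (gate i)
  core-gate i = core≢slot i i zero ,
    inj₂ (trans (blk-slot i zero) (sym (blk-slot i (suc zero))) , (λ _ → Gate-gate i) , λ c → contradiction c (¬Core-slot i zero))

  core-core : ∀ {i j} → i ≢ j → Adj G (core i) (core j)
  core-core i≢j = i≢j ∘ core-injective , inj₁ (Core-core _ , Core-core _)

  ¬Core-slot-adj : ∀ {v i} j → ¬ Core v → blk v ≡ i → v ≢ slot i (suc j) → Adj G v (slot i (suc j))
  ¬Core-slot-adj j ¬c refl v≢ = v≢ ,
    inj₂ (sym (blk-slot _ _) , (λ c → contradiction c ¬c) , λ c → contradiction c (¬Core-slot _ j))

  core-neighbour : ∀ {i w} → Adj G (core i) w → Core w ⊎ w ≡ gate i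
  core-neighbour (_ , inj₁ (_ , cw)) = inj₁ cw
  core-neighbour {i} (_ , inj₂ (b , f , _)) =
    inj₂ (trans (f (Core-core i)) (cong gate (trans (sym b) (blk-slot i zero))))

  connected : Connected G
  connected u v = toCore u ◅◅ coreToCore (blk u) (blk v) ◅◅ reverse (Graph.sym G) (toCore v)
    where
    toCore : ∀ u → Star (Adj G) u (core (blk u))
    toCore u with core? u | gate? u
    ... | yes c | _     = subst (Star (Adj G) u) c ε
    ... | no _  | yes g = subst (λ x → Star (Adj G) x (core (blk u))) (sym g) (Graph.sym G (core-gate (blk u)) ◅ ε)
    ... | no ¬c | no ¬g = ¬Core-slot-adj zero ¬c refl ¬g ◅ Graph.sym G (core-gate (blk u)) ◅ ε
    coreToCore : ∀ i j → Star (Adj G) (core i) (core j)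
    coreToCore i j with i ≟ j
    ... | yes refl = ε
    ... | no i≢j   = core-core i≢j ◅ ε

  -- The index i, unused by the core neighbours of core i, stands for the gate.
  nbr : Fin d → Fin d → Fin n
  nbr i j with j ≟ i
  ... | yes _ = gate i
  ... | no _  = core j

  nbr-injective : ∀ i → Injective _≡_ _≡_ (nbr i)
  nbr-injective i {j} {k} eq with j ≟ i | k ≟ i
  ... | yes refl | yes refl = refl
  ... | yes _    | no _     = contradiction (sym eq) (core≢slot k i zero)
  ... | no _     | yes _    = contradiction eq (core≢slot j i zero)
  ... | no _     | no _     = core-injective eq

  nbr-adj : ∀ i j → Adj G (core i) (nbr i j)
  nbr-adj i j with j ≟ i
  ... | yes _  = core-gate i
  ... | no j≢i = core-core (≢-sym j≢i)

  nbr-surjective : ∀ i {w} → Adj G (core i) w → ∃ λ j → nbr i j ≡ w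
  nbr-surjective i {w} iw with core-neighbour iw
  ... | inj₂ refl = i , eq
    where
    eq : nbr i i ≡ gate i
    eq with i ≟ i
    ... | yes _  = refl
    ... | no i≢i = contradiction refl i≢i
  ... | inj₁ cw = blk w , eq
    where
    eq : nbr i (blk w) ≡ w
    eq with blk w ≟ i
    ... | yes refl = contradiction (sym cw) (proj₁ iw)
    ... | no _     = sym cw

  degree-core : ∀ i → degree G (core i) ≡ d
  degree-core i = ≤-antisym (degree≤ G (nbr i) (nbr-surjective i))
    (≤degree G (nbr i) (nbr-injective i) (nbr-adj i))

  -- A vertex in one of the `d + 1` clique slots is adjacent to the other `d`, listed by `punchIn`;
  -- a surplus vertex is adjacent to all of them, and the first `d` suffice.
  degree-¬Core : ∀ v → ¬ Core v → d ≤ degree G v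
  degree-¬Core v ¬c with any? (λ j → v ≟ slot (blk v) (suc j))
  ... | yes (j , v≡) = ≤degree G (slot (blk v) ∘ suc ∘ punchIn j)
    (λ {k} {l} → punchIn-injective j k l ∘ suc-injective ∘ slot-injective (blk v))
    λ k → ¬Core-slot-adj _ ¬c refl λ v≡′ →
      punchInᵢ≢i j k (suc-injective (slot-injective (blk v) (trans (sym v≡′) v≡)))
  ... | no v≢ = ≤degree G (slot (blk v) ∘ suc ∘ inject₁)
    (inject₁-injective ∘ suc-injective ∘ slot-injective (blk v))
    λ k → ¬Core-slot-adj _ ¬c refl λ v≡ → v≢ (_ , v≡)

  minDegree : MinDegree G d
  minDegree = lower , core zero , degree-core zero
    where
    lower : ∀ v → d ≤ degree G v
    lower v = case core? v of λ
      { (no ¬c) → degree-¬Core v ¬c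
      ; (yes c) → subst (λ u → d ≤ degree G u) (sym c) (≤-reflexive (sym (degree-core (blk v))))
      }

  -- Edges forced into a spanning tree

  module _ (T : Graph n) (T-spanning : IsSpanningTree T G) where

    T⊆G : ∀ {u v} → Adj T u v → Adj G u v
    T⊆G = proj₁ T-spanning

    T-connected : Connected T
    T-connected = proj₁ (proj₂ T-spanning)

    -- The set of non-core vertices of block `i` can be left in `G` only along the edge from the
    -- gate to the core vertex.
    T-core-gate : ∀ i → Adj T (core i) (gate i)
    T-core-gate i with crossing (λ v → (blk v ≟ i) ×-dec ¬? (core? v)) (T-connected (gate i) (core i))
      (blk-slot i (suc zero) , ¬Core-slot i zero) (λ (_ , ¬c) → ¬c (Core-core i))
    ... | u , v , uv , (refl , ¬cu) , ¬Pv with T⊆G uv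
    ... | _ , inj₁ (cu , _) = contradiction cu ¬cu
    -- The edge stays in the block, so `v` escapes the set only by being the core vertex, which
    -- forces `u` to be the gate.
    ... | _ , inj₂ (b , _ , g) = Graph.sym T (subst₂ (Adj T) (g cv) (Core⇒core cv (sym b)) uv)
      where
      cv : Core v
      cv = decidable-stable (core? v) λ ¬cv → ¬Pv (sym b , ¬cv)

    -- Every edge of `G` leaving a block joins two core vertices.
    T-core-core : ∀ i → ∃ λ w → Adj T (core i) w × Core w
    T-core-core i with crossing (λ v → blk v ≟ i) (T-connected (core i) (core (other i)))
      (blk-slot i zero) (λ eq → punchInᵢ≢i i zero (trans (sym (blk-slot _ zero)) eq))
    ... | u , v , uv , b , b′ with T⊆G uv
    ... | _ , inj₁ (cu , cv) = v , subst (λ x → Adj T x v) (Core⇒core cu b) uv , cv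
    ... | _ , inj₂ (b≡ , _)  = contradiction (trans (sym b≡) b) b′

    2≤degree-core : ∀ i → 2 ≤ degree T (core i)
    2≤degree-core i with w , iw , cw ← T-core-core i =
      2≤degree T (λ { refl → ¬Core-slot i zero cw }) (T-core-gate i) iw

    continue : (∀ i → degree T (core i) ≢ 2) →
      ∀ u v → Core v → ∃ λ w → Adj T v w × Core w × w ≢ u
    continue ≢2 u v cv = subst (λ x → ∃ λ w → Adj T x w × Core w × w ≢ u) (sym cv) next
      where
      i = blk v
      next : ∃ λ w → Adj T (core i) w × Core w × w ≢ u
      -- Degree at least 3 leaves a neighbour besides the gate and `u`; not being the gate, it is a
      -- core vertex.
      next with w , iw , w≢gate , w≢u ← third-neighbour T (gate i) u (≤∧≢⇒< (2≤degree-core i) (≢-sym (≢2 i)))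
        with core-neighbour (T⊆G iw)
      ... | inj₁ cw = w , iw , cw , w≢u
      ... | inj₂ eq = contradiction eq w≢gate

    degree-2-vertex : ∃ λ v → Internal T v × degree T v ≡ 2
    degree-2-vertex with any? (λ i → degree T (core i) ≟ℕ 2)
    ... | yes (i , eq) = core i , 2≤degree-core i , eq
    ... | no none = contradiction
      (continue⇒cycle T Core (continue λ i eq → none (i , eq)) (core zero , Core-core zero))
      (proj₂ (proj₂ T-spanning))

theorem2 : (d n : ℕ) → 2 ≤ d → d * (d + 2) ≤ n →
    ∃ λ (G : Graph n) → Connected G × MinDegree G d ×
    ((T : Graph n) → IsSpanningTree T G → ∃ λ v → Internal T v × degree T v ≡ 2)
theorem2 d@(suc (suc m)) n (s≤s (s≤s z≤n)) le
  -- Commuting `d + 2` to `2 + d` makes it reduce to the `4 + m` slots of `Construction`.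
  with r , refl ← m≤n⇒∃[o]m+o≡n (subst (λ k → d * k ≤ n) (+-comm d 2) le)
  = G , connected , minDegree , degree-2-vertex
  where
  -- The r surplus vertices are put into block zero.
  blk : Fin (d * (2 + d) + r) → Fin d
  blk v = [ quotient (2 + d) , (λ _ → zero) ]′ (splitAt (d * (2 + d)) v)
  slot : Fin d → Fin (2 + d) → Fin (d * (2 + d) + r)
  slot i j = combine i j ↑ˡ r
  blk-slot : ∀ i j → blk (slot i j) ≡ i
  blk-slot i j rewrite splitAt-↑ˡ (d * (2 + d)) (combine i j) r = cong proj₁ (remQuot-combine i j)
  slot-injective : ∀ i → Injective _≡_ _≡_ (slot i)
  slot-injective i {j} {k} eq = combine-injectiveʳ i j i k (↑ˡ-injective r _ _ eq)
  open Construction blk slot blk-slot slot-injective
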